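{- Let $k\ge 4$ and $n\ge k+2$ be integers. Then every $k$-critical graph on $n$ vertices contains a cycle of length at least $\frac{\log n}{100\log k}$.
   Context: All graphs are finite and simple. A graph $G$ is $k$-critical if $G$ is not $(k-1)$-colorable but every proper subgraph of $G$ is $(k-1)$-colorable. The length of a cycle is its number of edges. Logarithms are to any fixed base greater than $1$ (the quotient does not depend on the base). -}

module Defs where

open import Data.Nat using (ℕ; suc; _+_; _≤_; _∸_)
open import Data.Fin using (Fin; zero; fromℕ; toℕ)
open import Data.Bool using (Bool; true; false; _∧_)
open import Data.Product using (Σ; _×_; ∃)
open import Data.Sum using (_⊎_)
open import Relation.Binary.PropositionalEquality using (_≡_; _≢_)
open import Function.Definitions using (Injective)

record Graph (n : ℕ) : Set where
  field
    adj   : Fin n → Fin n → Bool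
    sym   : ∀ u v → adj u v ≡ adj v u
    irrefl : ∀ v → adj v v ≡ false
open Graph public

Colorable : ∀ {n} → ℕ → Graph n → Set
Colorable {n} m G =
  Σ (Fin n → Fin m) λ c → ∀ u v → adj G u v ≡ true → c u ≢ c v

record Subgraph {n : ℕ} (G : Graph n) : Set where
  field
    vert  : Fin n → Bool
    edge  : Fin n → Fin n → Bool
    edge-sym : ∀ u v → edge u v ≡ edge v u
    edge⊆ : ∀ u v → edge u v ≡ true → adj G u v ≡ true
    edge-ends : ∀ u v → edge u v ≡ true → vert u ≡ true × vert v ≡ true
open Subgraph public

Proper : ∀ {n} {G : Graph n} → Subgraph G → Set
Proper {n} {G} H =
  (Σ (Fin n) λ v → vert H v ≡ false)
  ⊎ (Σ (Fin n) λ u → Σ (Fin n) λ v → adj G u v ≡ true × edge H u v ≡ false)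

-- A proper colouring of the subgraph H with m colours (only the vertices
-- of H matter; the colours of other vertices are irrelevant).
SubColorable : ∀ {n} {G : Graph n} → ℕ → Subgraph G → Set
SubColorable {n} m H =
  Σ (Fin n → Fin m) λ c → ∀ u v → edge H u v ≡ true → c u ≢ c v

Critical : ∀ {n} → ℕ → Graph n → Set
Critical k G =
  (Colorable (k ∸ 1) G → Data.Empty.⊥)
  × (∀ (H : Subgraph G) → Proper H → SubColorable (k ∸ 1) H)
  where import Data.Empty

HasCycleOfLength : ∀ {n} → Graph n → ℕ → Set
HasCycleOfLength {n} G L =
  Σ ℕ λ m → (L ≡ 3 + m) ×
  Σ (Fin (3 + m) → Fin n) λ c →
    Injective _≡_ _≡_ c
    × (∀ (i j : Fin (3 + m)) → toℕ j ≡ suc (toℕ i) → adj G (c i) (c j) ≡ true)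
    × adj G (c (fromℕ (2 + m))) (c zero) ≡ true

module Submission where

open import Defs hiding (sym)
open import Data.Bool.Base using (Bool; true; false; _∧_; not; if_then_else_)
open import Data.Bool.Properties using (∧-comm) renaming (_≟_ to _≟ᵇ_)
open import Data.Empty using (⊥; ⊥-elim)
open import Data.Fin.Base using (Fin; zero; suc; fromℕ; fromℕ<; toℕ; combine)
open import Data.Fin.Permutation.Components using (transpose; transpose-inverse)
open import Data.Fin.Properties using (_≟_; any?; combine-injective; injective⇒≤)
  renaming (suc-injective to Fin-suc-injective)
open import Data.Fin.Subset using (Subset; _∈_; _∉_; _⊆_; _⊂_; _∩_; _∪_; ∁; ⁅_⁆; ∣_∣; Nonempty)
  renaming (⊤ to full)
open import Data.Fin.Subset.Properties
  using (_∈?_; _⊆?_; nonempty?; anySubset?; ∈⊤; x∈⁅x⁆; x∈⁅y⁆⇒x≡y; x∈p∩q⁺; x∈p∩q⁻;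
         x∈p∪q⁺; x∈p∪q⁻; x∈∁p⇒x∉p; x∉p⇒x∈∁p; p⊂q⇒∣p∣<∣q∣)
open import Data.Nat using (ℕ; zero; suc; _+_; _*_; _^_; _≤_; _<_; _∸_; >-nonZero; z≤n; s≤s)
open import Data.Nat.Properties
  using (suc-pred; suc-injective; ≤-refl; ≤-reflexive; ≤-trans; ≤-total; ≤-pred; <-≤-trans; _≤?_; ≰⇒≥;
         n≤1+n; m≤m+n; m≤n*m; +-suc; +-comm; +-assoc; +-monoˡ-≤; +-monoʳ-≤; ^-monoʳ-≤; m^n>0;
         module ≤-Reasoning)
open import Data.Product using (Σ; ∃; ∃₂; _×_; _,_; proj₁; proj₂)
open import Data.Sum using (_⊎_; inj₁; inj₂; [_,_]′)
open import Data.Vec.Functional using (updateAt)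
open import Data.Vec.Functional.Properties using (updateAt-updates; updateAt-minimal)
open import Function.Base using (_∘_; id; case_of_)
open import Function.Definitions using (Injective)
open import Relation.Binary.PropositionalEquality using (_≡_; _≢_; refl; sym; trans; cong; subst)
open import Relation.Nullary using (¬_; Dec; does; yes; no; contradiction)
open import Relation.Nullary.Decidable using (_×-dec_; _⊎-dec_; ¬?; dec-true; dec-false)
open import Relation.Unary using (Decidable)

-- If G has an elimination forest of height d, then a (q+1)-critical G has at
-- most (q+1)^d vertices: label each vertex s by the colours that a q-colouring
-- of G - s gives to the ancestors of s.  Two vertices in different branches
-- with equal colours on their common ancestors would allow their colourings
-- to be glued to a q-colouring of G.
--
-- A graph without cut vertices has an elimination forest whose height is at
-- most its circumference.  More precisely, for x ≠ y the forest of G - y has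
-- height at most the length of some x-y path.  To see this, delete x.  The
-- graph G - x is a tree of blocks rooted at y, every leaf block of which is
-- adjacent to x; hanging the forests of the blocks below one another gives
-- height at most the total length of paths through some chain of blocks, and
-- such a chain of paths together with one edge to x is an x-y path, which is
-- closed to a cycle when x and y are adjacent.  For the induction, blocks are
-- replaced by arbitrary separations at a single vertex, and the part that is
-- cut off is remembered as a weight on that vertex.

-- Vertex sets and maximisers.

VSet : ℕ → Set₁
VSet n = Fin n → Set

infixl 6 _∖_
_∖_ : ∀ {n} → VSet n → Fin n → VSet n
(S ∖ v) u = S u × u ≢ v

maximiser : ∀ {n} {P : Fin n → Set} → Decidable P → (f : Fin n → ℕ) → ∃ P →
            ∃ λ x → P x × ∀ u → P u → f u ≤ f x
maximiser {suc n} P? f (p , Pp) with any? (P? ∘ suc) | P? zero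
maximiser P? f (zero , Pp) | no ∄ | _ =
  zero , Pp , λ { zero _ → ≤-refl ; (suc u) Pu → contradiction (u , Pu) ∄ }
maximiser P? f (suc p , Pp) | no ∄ | _ = contradiction (p , Pp) ∄
... | yes ex | P0? with maximiser (P? ∘ suc) (f ∘ suc) ex | P0?
...   | x , Px , max | no ¬P0 = suc x , Px , λ { zero P0 → contradiction P0 ¬P0 ; (suc u) → max u }
...   | x , Px , max | yes P0 with ≤-total (f zero) (f (suc x))
...     | inj₁ f0≤ = suc x , Px , λ { zero _ → f0≤ ; (suc u) → max u }
...     | inj₂ ≤f0 = zero , P0 , λ { zero _ → ≤-refl ; (suc u) Pu → ≤-trans (max u Pu) ≤f0 }

-- Elimination forests with weights.

module _ {n : ℕ} (G : Graph n) where

  infix 4 _~_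
  _~_ : Fin n → Fin n → Set
  u ~ v = adj G u v ≡ true

  ~-sym : ∀ {u v} → u ~ v → v ~ u
  ~-sym {u} {v} e = trans (Graph.sym G v u) e

  ~⇒≢ : ∀ {u v} → u ~ v → u ≢ v
  ~⇒≢ {u} e refl with trans (sym e) (irrefl G u)
  ... | ()

  -- An elimination forest of S of height at most d.  A vertex with r levels
  -- strictly below its own must have weight at most 1 + r; a positive weight
  -- thus reserves room for a further forest to be hung below the vertex.
  data Elimination (α : Fin n → ℕ) : VSet n → ℕ → Set₁ where
    empty  : ∀ {S d} → (∀ {u} → ¬ S u) → Elimination α S d
    remove : ∀ {S d} v → (S v → α v ≤ suc d) → Elimination α (S ∖ v) d → Elimination α S (suc d)
    split  : ∀ {S d} (T : VSet n) → Decidable T →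
             (∀ {u w} → S u → T u → S w → ¬ T w → ¬ u ~ w) →
             Elimination α (λ u → S u × T u) d → Elimination α (λ u → S u × ¬ T u) d →
             Elimination α S d

  -- Adding `m` blank levels at the bottom gives every vertex `m` more levels below it, so the
  -- weights may grow by `m`.
  weaken : ∀ {α β S S′ d e} m → (∀ {u} → S u → S′ u) →
           (∀ {u r} → S u → α u ≤ suc r → β u ≤ suc (m + r)) → m + d ≤ e →
           Elimination α S′ d → Elimination β S e
  weaken m ⊆S′ β≤ le (empty ∄) = empty (∄ ∘ ⊆S′)
  weaken {d = suc d} m ⊆S′ β≤ le (remove v α≤ E) with ≤-trans (≤-reflexive (sym (+-suc m d))) le
  ... | s≤s le′ = remove v (λ Sv → ≤-trans (β≤ Sv (α≤ (⊆S′ Sv))) (s≤s le′))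
                    (weaken m (λ (Su , u≢v) → ⊆S′ Su , u≢v) (β≤ ∘ proj₁) le′ E)
  weaken m ⊆S′ β≤ le (split T T? ≁ E F) =
    split T T? (λ Su Tu Sw Tw → ≁ (⊆S′ Su) Tu (⊆S′ Sw) Tw)
      (weaken m (λ (Su , Tu) → ⊆S′ Su , Tu) (β≤ ∘ proj₁) le E)
      (weaken m (λ (Su , Tu) → ⊆S′ Su , Tu) (β≤ ∘ proj₁) le F)

  -- The weight of `v` reserves `e` levels below it. Since `Q` meets the rest only at `v`, its
  -- forest fits there without raising the height, and the weights may then drop to `β`.
  hang : ∀ {α β S Q d e} v → S v → Decidable Q → suc e ≤ α v → (∀ u → β u ≤ α u) →
         (∀ {u} → S u → ¬ Q u) → (∀ {u w} → Q u → S w → w ≢ v → ¬ u ~ w) →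
         Elimination α S d → Elimination β Q e → Elimination β (λ u → S u ⊎ Q u) d
  hang v Sv Q? e< β≤α disj ≁ (empty ∄) F = contradiction Sv ∄
  hang {Q = Q} v Sv Q? e< β≤α disj ≁ (remove w αw≤ E) F with w ≟ v
  -- Without `v` nothing joins `Q` to the rest, so the two forests stand side by side; `e ≤ d`
  -- follows from `suc e ≤ α v ≤ suc d`.
  ... | yes refl =
        remove v (λ _ → ≤-trans (β≤α v) (αw≤ Sv))
          (split Q Q?
            (λ { _ Qu (inj₁ Sw , w≢v) ¬Qw → ≁ Qu Sw w≢v
               ; _ Qu (inj₂ Qw , _) ¬Qw → contradiction Qw ¬Qw })
            (weaken 0 proj₂ (λ _ → id) (≤-pred (≤-trans e< (αw≤ Sv))) F)
            (weaken 0 (λ { ((inj₁ Su , u≢v) , _) → Su , u≢v ; ((inj₂ Qu , _) , ¬Qu) → contradiction Qu ¬Qu })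
                    (λ {u} _ → ≤-trans (β≤α u)) ≤-refl E))
  ... | no w≢v with Q? w
  -- Here `w` lies in `Q`, hence outside `S`. It must stay available to the forest of `Q`, so this
  -- level is left blank.
  ...   | yes Qw =
          weaken 1 (λ { (inj₁ Su) → inj₁ (Su , λ { refl → disj Su Qw }) ; (inj₂ Qu) → inj₂ Qu })
                   (λ _ p → ≤-trans p (n≤1+n _)) ≤-refl
            (hang v (Sv , w≢v ∘ sym) Q? e< β≤α (disj ∘ proj₁) (λ Qu (Sw , _) → ≁ Qu Sw) E F)
  ...   | no ¬Qw =
          remove w (λ { (inj₁ Sw) → ≤-trans (β≤α w) (αw≤ Sw) ; (inj₂ Qw) → contradiction Qw ¬Qw })
            (weaken 0 (λ { (inj₁ Su , u≢w) → inj₁ (Su , u≢w) ; (inj₂ Qu , _) → inj₂ Qu }) (λ _ → id) ≤-refl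
              (hang v (Sv , w≢v ∘ sym) Q? e< β≤α (disj ∘ proj₁) (λ Qu (Sw , _) → ≁ Qu Sw) E F))
  hang {Q = Q} v Sv Q? e< β≤α disj ≁ (split T T? ≁T E E′) F with T? v
  -- `T` is arbitrary outside `S` and may cut through `Q`. It is corrected so that all of `Q` goes
  -- to the side of `v`.
  ... | yes Tv =
        split (λ u → T u ⊎ Q u) (λ u → T? u ⊎-dec Q? u)
          (λ { _ _ (inj₂ Qw) ¬TQw → contradiction (inj₂ Qw) ¬TQw
             ; _ (inj₂ Qu) (inj₁ Sw) ¬TQw → ≁ Qu Sw λ { refl → ¬TQw (inj₁ Tv) }
             ; (inj₁ Su) (inj₁ Tu) (inj₁ Sw) ¬TQw → ≁T Su Tu Sw (¬TQw ∘ inj₁)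
             ; (inj₂ Qu) (inj₁ Tu) (inj₁ Sw) ¬TQw → ≁ Qu Sw λ { refl → ¬TQw (inj₁ Tv) } })
          (weaken 0 (λ { (_ , inj₂ Qu) → inj₂ Qu ; (inj₂ Qu , _) → inj₂ Qu
                       ; (inj₁ Su , inj₁ Tu) → inj₁ (Su , Tu) })
                  (λ _ → id) ≤-refl
            (hang v (Sv , Tv) Q? e< β≤α (disj ∘ proj₁) (λ Qu (Sw , _) → ≁ Qu Sw) E F))
          (weaken 0 (λ { (inj₁ Su , ¬TQu) → Su , ¬TQu ∘ inj₁
                       ; (inj₂ Qu , ¬TQu) → contradiction (inj₂ Qu) ¬TQu })
                  (λ {u} _ → ≤-trans (β≤α u)) ≤-refl E′)
  ... | no ¬Tv =
        split (λ u → T u × ¬ Q u) (λ u → T? u ×-dec ¬? (Q? u))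
          (λ { (inj₂ Qu) (_ , ¬Qu) → contradiction Qu ¬Qu
             ; (inj₁ Su) (Tu , _) (inj₁ Sw) ¬TQw → ≁T Su Tu Sw λ Tw → ¬TQw (Tw , disj Sw)
             ; (inj₁ Su) (Tu , _) (inj₂ Qw) _ u~w → ≁ Qw Su (λ { refl → ¬Tv Tu }) (~-sym u~w) })
          (weaken 0 (λ { (inj₁ Su , Tu , _) → Su , Tu ; (inj₂ Qu , _ , ¬Qu) → contradiction Qu ¬Qu })
                  (λ {u} _ → ≤-trans (β≤α u)) ≤-refl E)
          (weaken 0 (λ { (inj₁ Su , ¬TQu) → inj₁ (Su , λ Tu → ¬TQu (Tu , disj Su)) ; (inj₂ Qu , _) → inj₂ Qu })
                  (λ _ → id) ≤-refl
            (hang v (Sv , ¬Tv) Q? e< β≤α (disj ∘ proj₁) (λ Qu (Sw , _) → ≁ Qu Sw) E′ F))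

  -- Colourings of vertex-deleted graphs: order against height, and cut vertices.

  record VertexDeletionColourings (q : ℕ) : Set where
    field
      c      : Fin n → Fin n → Fin q
      proper : ∀ v {u w} → u ≢ v → w ≢ v → u ~ w → c v u ≢ c v w

  module _ {q : ℕ} (¬col : ¬ Colorable q G) (colourings : VertexDeletionColourings q) where
    open VertexDeletionColourings colourings

    -- X is the set of vertices already eliminated above S.
    encode : ∀ {α S d} (X : VSet n) → Decidable S → (∀ {u} → S u → ¬ X u) →
             (∀ {u w} → S u → u ~ w → S w ⊎ X w) → Elimination α S d →
             Σ (Fin n → Fin (suc q ^ d)) λ f → ∀ {s t} → S s → S t →
               (∀ x → X x → c s x ≡ c t x) → f s ≡ f t → s ≡ t
    encode {d = d} X S? disj cl (empty ∄) =
      (λ _ → fromℕ< (m^n>0 (suc q) d)) , λ Ss → contradiction Ss ∄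
    encode {S = S} {d = suc d} X S? disj cl (remove v _ E)
      with encode (λ u → X u ⊎ u ≡ v) (λ u → S? u ×-dec ¬? (u ≟ v))
             (λ { (Su , _) (inj₁ Xu) → disj Su Xu ; (_ , u≢v) (inj₂ u≡v) → u≢v u≡v })
             closed E
      where
      closed : ∀ {u w} → (S ∖ v) u → u ~ w → (S ∖ v) w ⊎ (X w ⊎ w ≡ v)
      closed {w = w} (Su , _) u~w with cl Su u~w | w ≟ v
      ... | _ | yes w≡v = inj₂ (inj₂ w≡v)
      ... | inj₁ Sw | no w≢v = inj₁ (Sw , w≢v)
      ... | inj₂ Xw | _ = inj₂ (inj₁ Xw)
    ... | f , f-inj = (λ s → combine (label s) (f s)) , inj
      where
      label : Fin n → Fin (suc q)
      label s with s ≟ v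
      -- The extra label `zero` marks `v` itself; hence the base `suc q`.
      ... | yes _ = zero
      ... | no _ = suc (c s v)

      inj : ∀ {s t} → S s → S t → (∀ x → X x → c s x ≡ c t x) →
            combine (label s) (f s) ≡ combine (label t) (f t) → s ≡ t
      inj {s} {t} Ss St agree eq with combine-injective (label s) (f s) (label t) (f t) eq
      ... | l , e with s ≟ v | t ≟ v
      ... | yes refl | yes refl = refl
      inj Ss St agree eq | () , e | yes _ | no _
      inj Ss St agree eq | () , e | no _ | yes _
      ... | no s≢v | no t≢v =
            f-inj (Ss , s≢v) (St , t≢v)
              (λ { x (inj₁ Xx) → agree x Xx ; x (inj₂ refl) → Fin-suc-injective l }) e
    encode {S = S} {d = d} X S? disj cl (split T T? ≁ E F)
      with encode X (λ u → S? u ×-dec T? u) (disj ∘ proj₁) closedˡ E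
         | encode X (λ u → S? u ×-dec ¬? (T? u)) (disj ∘ proj₁) closedʳ F
      where
      closedˡ : ∀ {u w} → S u × T u → u ~ w → S w × T w ⊎ X w
      closedˡ {w = w} (Su , Tu) u~w with cl Su u~w | T? w
      ... | inj₁ Sw | yes Tw = inj₁ (Sw , Tw)
      ... | inj₁ Sw | no ¬Tw = contradiction u~w (≁ Su Tu Sw ¬Tw)
      ... | inj₂ Xw | _ = inj₂ Xw

      closedʳ : ∀ {u w} → S u × ¬ T u → u ~ w → S w × ¬ T w ⊎ X w
      closedʳ {w = w} (Su , ¬Tu) u~w with cl Su u~w | T? w
      ... | inj₁ Sw | no ¬Tw = inj₁ (Sw , ¬Tw)
      ... | inj₁ Sw | yes Tw = contradiction (~-sym u~w) (≁ Sw Tw Su ¬Tu)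
      ... | inj₂ Xw | _ = inj₂ Xw
    ... | f , f-inj | g , g-inj = code , inj
      where
      code : Fin n → Fin (suc q ^ d)
      code s with T? s
      ... | yes _ = f s
      ... | no _ = g s

      -- Colour the part of `S` in `T` by `c t` and everything else by `c s`: neither colouring is
      -- used at its own deleted vertex, and edges leaving the part end in `X`, where both agree. So
      -- the two sides of a split can share the same codes.
      glue : ∀ {s t} → S s → T s → S t → ¬ T t → ¬ (∀ x → X x → c s x ≡ c t x)
      glue {s} {t} Ss Ts St ¬Tt agree = ¬col (col , col-proper)
        where
        ST? : Decidable (λ u → S u × T u)
        ST? u = S? u ×-dec T? u

        col : Fin n → Fin q
        col u with ST? u
        ... | yes _ = c t u
        ... | no _ = c s u

        across : ∀ {u w} → S u × T u → ¬ (S w × T w) → u ~ w → c t u ≢ c s w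
        across {w = w} (Su , Tu) ¬STw u~w eq with cl Su u~w
        ... | inj₁ Sw = ≁ Su Tu Sw (λ Tw → ¬STw (Sw , Tw)) u~w
        ... | inj₂ Xw = proper t (λ { refl → ¬Tt Tu }) (λ { refl → disj St Xw }) u~w (trans eq (agree w Xw))

        col-proper : ∀ u w → u ~ w → col u ≢ col w
        col-proper u w u~w with ST? u | ST? w
        ... | yes (_ , Tu) | yes (_ , Tw) = proper t (λ { refl → ¬Tt Tu }) (λ { refl → ¬Tt Tw }) u~w
        ... | yes STu | no ¬STw = across STu ¬STw u~w
        ... | no ¬STu | yes STw = across STw ¬STu (~-sym u~w) ∘ sym
        ... | no ¬STu | no ¬STw = proper s (λ { refl → ¬STu (Ss , Ts) }) (λ { refl → ¬STw (Ss , Ts) }) u~w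

      inj : ∀ {s t} → S s → S t → (∀ x → X x → c s x ≡ c t x) → code s ≡ code t → s ≡ t
      inj {s} {t} Ss St agree eq with T? s | T? t
      ... | yes Ts | yes Tt = f-inj (Ss , Ts) (St , Tt) agree eq
      ... | yes Ts | no ¬Tt = contradiction agree (glue Ss Ts St ¬Tt)
      ... | no ¬Ts | yes Tt = contradiction (λ x Xx → sym (agree x Xx)) (glue St Tt Ss ¬Ts)
      ... | no ¬Ts | no ¬Tt = g-inj (Ss , ¬Ts) (St , ¬Tt) agree eq

    order≤ : ∀ {α S d} → (∀ u → S u) → Elimination α S d → n ≤ suc q ^ d
    order≤ all E with encode (λ _ → ⊥) (λ u → yes (all u)) (λ _ ()) (λ {_} {w} _ _ → inj₁ (all w)) E
    ... | f , f-inj = injective⇒≤ λ {s} {t} → f-inj (all s) (all t) (λ _ ())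

    -- Colourings of the two sides of a cut vertex u could be glued after
    -- permuting the colours so that they agree at u.
    no-cut-vertex : ∀ (Q : Subset n) u → Nonempty Q → u ∉ Q → (∃ λ w → w ∉ Q × w ≢ u) →
                    ∃₂ λ s t → s ∈ Q × t ∉ Q × t ≢ u × s ~ t
    no-cut-vertex Q u (s₀ , s₀∈Q) u∉Q (t₀ , t₀∉Q , t₀≢u)
      with any? (λ s → any? λ t → s ∈? Q ×-dec ¬? (t ∈? Q) ×-dec ¬? (t ≟ u) ×-dec adj G s t ≟ᵇ true)
    ... | yes edge = edge
    ... | no ∄edge = contradiction (col , col-proper) ¬col
      where
      π : Fin q → Fin q
      π = transpose (c t₀ u) (c s₀ u)

      π-matches : π (c t₀ u) ≡ c s₀ u
      π-matches rewrite dec-true (c t₀ u ≟ c t₀ u) refl = refl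

      π-injective : ∀ {i j} → π i ≡ π j → i ≡ j
      π-injective eq = trans (sym (transpose-inverse (c s₀ u) (c t₀ u)))
        (trans (cong (transpose (c s₀ u) (c t₀ u)) eq) (transpose-inverse (c s₀ u) (c t₀ u)))

      col : Fin n → Fin q
      col w with w ∈? Q
      ... | yes _ = π (c t₀ w)
      ... | no _ = c s₀ w

      across : ∀ {s t} → s ∈ Q → t ∉ Q → s ~ t → π (c t₀ s) ≢ c s₀ t
      across {s} {t} s∈Q t∉Q s~t eq with t ≟ u
      ... | yes refl = proper t₀ (λ { refl → t₀∉Q s∈Q }) (t₀≢u ∘ sym) s~t
                         (π-injective (trans eq (sym π-matches)))
      ... | no t≢u = ∄edge (s , t , s∈Q , t∉Q , t≢u , s~t)

      col-proper : ∀ v w → v ~ w → col v ≢ col w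
      col-proper v w v~w with v ∈? Q | w ∈? Q
      ... | yes v∈Q | yes w∈Q =
            proper t₀ (λ { refl → t₀∉Q v∈Q }) (λ { refl → t₀∉Q w∈Q }) v~w ∘ π-injective
      ... | yes v∈Q | no w∉Q = across v∈Q w∉Q v~w
      ... | no v∉Q | yes w∈Q = across w∈Q v∉Q (~-sym v~w) ∘ sym
      ... | no v∉Q | no w∉Q = proper s₀ (λ { refl → v∉Q s₀∈Q }) (λ { refl → w∉Q s₀∈Q }) v~w

  critical⇒vertexDeletionColourings : ∀ {k} → Critical k G → VertexDeletionColourings (k ∸ 1)
  critical⇒vertexDeletionColourings (_ , sub) = record
    { c      = λ v → proj₁ (sub (deleted v) (inj₁ (v , vert-self v)))
    ; proper = λ v {u} {w} u≢v w≢v u~w →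
        proj₂ (sub (deleted v) (inj₁ (v , vert-self v))) u w (kept u≢v w≢v u~w)
    }
    where
    other : Fin n → Fin n → Bool
    other v u = not (does (u ≟ v))

    vert-self : ∀ v → other v v ≡ false
    vert-self v = cong not (dec-true (v ≟ v) refl)

    kept : ∀ {v u w} → u ≢ v → w ≢ v → u ~ w → adj G u w ∧ (other v u ∧ other v w) ≡ true
    kept {v} {u} {w} u≢v w≢v u~w
      rewrite u~w | dec-false (u ≟ v) u≢v | dec-false (w ≟ v) w≢v = refl

    deleted : Fin n → Subgraph G
    deleted v .vert = other v
    deleted v .edge u w = adj G u w ∧ (other v u ∧ other v w)
    deleted v .edge-sym u w rewrite Graph.sym G u w | ∧-comm (other v u) (other v w) = refl
    deleted v .edge⊆ u w e with adj G u w | e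
    ... | true | _ = refl
    deleted v .edge-ends u w e with adj G u w | other v u | other v w | e
    ... | true | true | true | _ = refl , refl

  -- Paths and cycles.

  -- The set shrinks along the path, so simplicity is built into the type.
  data Path : VSet n → Fin n → Fin n → ℕ → Set₁ where
    stop : ∀ {S u} → S u → Path S u u 0
    step : ∀ {S u v w ℓ} → S u → u ~ v → Path (S ∖ u) v w ℓ → Path S u w (suc ℓ)

  Path-mono : ∀ {S S′ u w ℓ} → (∀ {v} → S v → S′ v) → Path S u w ℓ → Path S′ u w ℓ
  Path-mono ⊆S′ (stop Su) = stop (⊆S′ Su)
  Path-mono ⊆S′ (step Su u~v P) = step (⊆S′ Su) u~v (Path-mono (λ (Sv , v≢u) → ⊆S′ Sv , v≢u) P)

  end∈ : ∀ {S u w ℓ} → Path S u w ℓ → S w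
  end∈ (stop Su) = Su
  end∈ (step _ _ P) = proj₁ (end∈ P)

  append : ∀ {S T U u v w ℓ m} → (∀ {x} → S x → T x → x ≡ v) →
           (∀ {x} → S x → U x) → (∀ {x} → T x → U x) →
           Path S u v ℓ → Path T v w m → Path U u w (ℓ + m)
  append meet S⊆U T⊆U (stop _) P′ = Path-mono T⊆U P′
  append meet S⊆U T⊆U (step Su u~v P) P′ =
    step (S⊆U Su) u~v
      (append (meet ∘ proj₁) (λ (Sx , x≢u) → S⊆U Sx , x≢u)
        -- If `u` were in `T` it would be `v`, which is the end of `P`, and `P` avoids `u`.
        (λ Tx → T⊆U Tx , λ { refl → proj₂ (end∈ P) (sym (meet Su Tx)) }) P P′)

  vertex : ∀ {S u w ℓ} → Path S u w ℓ → Fin (suc ℓ) → Fin n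
  vertex {u = u} _ zero = u
  vertex (step _ _ P) (suc i) = vertex P i

  vertex∈ : ∀ {S u w ℓ} (P : Path S u w ℓ) i → S (vertex P i)
  vertex∈ (stop Su) zero = Su
  vertex∈ (step Su _ _) zero = Su
  vertex∈ (step _ _ P) (suc i) = proj₁ (vertex∈ P i)

  vertex-injective : ∀ {S u w ℓ} (P : Path S u w ℓ) → Injective _≡_ _≡_ (vertex P)
  vertex-injective P {zero} {zero} _ = refl
  vertex-injective (step _ _ P) {zero} {suc j} eq = contradiction (sym eq) (proj₂ (vertex∈ P j))
  vertex-injective (step _ _ P) {suc i} {zero} eq = contradiction eq (proj₂ (vertex∈ P i))
  vertex-injective (step _ _ P) {suc i} {suc j} eq = cong suc (vertex-injective P eq)

  vertex-adjacent : ∀ {S u w ℓ} (P : Path S u w ℓ) i j → toℕ j ≡ suc (toℕ i) → vertex P i ~ vertex P j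
  vertex-adjacent (step _ u~v P) zero (suc zero) _ = u~v
  vertex-adjacent (step _ _ P) (suc i) (suc j) eq = vertex-adjacent P i j (suc-injective eq)

  vertex-last : ∀ {S u w ℓ} (P : Path S u w ℓ) → vertex P (fromℕ ℓ) ≡ w
  vertex-last (stop _) = refl
  vertex-last (step _ _ P) = vertex-last P

  closePath : ∀ {S u w m} → Path S u w (2 + m) → w ~ u → HasCycleOfLength G (3 + m)
  closePath {u = u} {m = m} P w~u =
    m , refl , vertex P , vertex-injective P , vertex-adjacent P ,
    subst (_~ u) (sym (vertex-last P)) w~u

  -- Rooted vertex sets, exits and separations.

  -- The exits are the vertices of positive weight.  The field hanging says that
  -- a part of H attached to the rest at a single vertex contains an exit.
  record Rooted (H : Subset n) (y : Fin n) (α : Fin n → ℕ) : Set where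
    field
      root∈  : y ∈ H
      exit   : ∃ λ a → a ∈ H × 1 ≤ α a
      connected : ∀ Q → Nonempty Q → Q ⊆ H → y ∉ Q →
                  ∃₂ λ s t → s ∈ Q × t ∈ H × t ∉ Q × s ~ t
      hanging : ∀ Q u → Nonempty Q → Q ⊆ H → y ∉ Q → u ∈ H → u ∉ Q →
                (∃₂ λ s t → s ∈ Q × t ∈ H × t ∉ Q × t ≢ u × s ~ t) ⊎ (∃ λ s → s ∈ Q × 1 ≤ α s)
  open Rooted

  -- The invariant of the induction. The weight of `end` counts the length still to be gained beyond
  -- that exit, and `root≤` lets the root carry its own weight above the forest.
  record LongPath (H : Subset n) (y : Fin n) (α : Fin n → ℕ) : Set₁ where
    constructor longPath
    field
      {height len} : ℕ
      {end}  : Fin n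
      root≤  : α y ≤ suc height
      forest : Elimination α ((_∈ H) ∖ y) height
      path   : Path (_∈ H) y end len
      end-exit : 1 ≤ α end
      height< : suc height ≤ len + α end

  -- `Q` is attached to the rest of `H` only at `v`, which may be the root; `beyond` makes `Q`
  -- together with `v` smaller than `H`.
  record Separation (H : Subset n) (y : Fin n) (Q : Subset n) (v : Fin n) : Set where
    constructor separation
    field
      Q≠∅    : Nonempty Q
      Q⊆H    : Q ⊆ H
      y∉Q    : y ∉ Q
      v∈H    : v ∈ H
      v∉Q    : v ∉ Q
      beyond : ∃ λ w → w ∈ H × w ∉ Q × w ≢ v
      ¬leave : ¬ ∃₂ λ s t → s ∈ Q × t ∈ H × t ∉ Q × t ≢ v × s ~ t

  -- A finite search over all subsets, possible because `H` and `Q` are Boolean subsets and not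
  -- predicates.
  separation? : ∀ H y → Dec (∃₂ (Separation H y))
  separation? H y
    with anySubset? (λ Q → any? λ v →
           nonempty? Q ×-dec Q ⊆? H ×-dec ¬? (y ∈? Q) ×-dec v ∈? H ×-dec ¬? (v ∈? Q) ×-dec
           any? (λ w → w ∈? H ×-dec ¬? (w ∈? Q) ×-dec ¬? (w ≟ v)) ×-dec
           ¬? (any? λ s → any? λ t →
                s ∈? Q ×-dec t ∈? H ×-dec ¬? (t ∈? Q) ×-dec ¬? (t ≟ v) ×-dec adj G s t ≟ᵇ true))
  ... | yes (Q , v , Q≠∅ , Q⊆H , y∉Q , v∈H , v∉Q , beyond , ¬leave) =
        yes (Q , v , separation Q≠∅ Q⊆H y∉Q v∈H v∉Q beyond ¬leave)
  ... | no ∄ = no λ (Q , v , separation Q≠∅ Q⊆H y∉Q v∈H v∉Q beyond ¬leave) →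
        ∄ (Q , v , Q≠∅ , Q⊆H , y∉Q , v∈H , v∉Q , beyond , ¬leave)

  -- Inductive step at a separation.

  module _ {H : Subset n} {y : Fin n} {α : Fin n → ℕ} {Q : Subset n} {v : Fin n}
           (R : Rooted H y α) (sep : Separation H y Q v) where
    open Separation sep

    near far : Subset n
    near = H ∩ ∁ Q
    far = Q ∪ ⁅ v ⁆

    near⁻ : ∀ {u} → u ∈ near → u ∈ H × u ∉ Q
    near⁻ u∈ with x∈p∩q⁻ H (∁ Q) u∈
    ... | u∈H , u∈∁Q = u∈H , x∈∁p⇒x∉p u∈∁Q

    near⁺ : ∀ {u} → u ∈ H → u ∉ Q → u ∈ near
    near⁺ u∈H u∉Q = x∈p∩q⁺ (u∈H , x∉p⇒x∈∁p u∉Q)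

    far⁻ : ∀ {u} → u ∈ far → u ∈ Q ⊎ u ≡ v
    far⁻ u∈ with x∈p∪q⁻ Q ⁅ v ⁆ u∈
    ... | inj₁ u∈Q = inj₁ u∈Q
    ... | inj₂ u∈v = inj₂ (x∈⁅y⁆⇒x≡y v u∈v)

    Q⊆far : ∀ {u} → u ∈ Q → u ∈ far
    Q⊆far u∈Q = x∈p∪q⁺ (inj₁ u∈Q)

    v∈far : v ∈ far
    v∈far = x∈p∪q⁺ {p = Q} (inj₂ (x∈⁅x⁆ v))

    far⊆H : far ⊆ H
    far⊆H u∈ with far⁻ u∈
    ... | inj₁ u∈Q = Q⊆H u∈Q
    ... | inj₂ refl = v∈H

    neighbours : ∀ {s t} → s ∈ Q → t ∈ H → s ~ t → t ∈ far
    neighbours {s} {t} s∈Q t∈H s~t with t ∈? Q | t ≟ v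
    ... | yes t∈Q | _ = Q⊆far t∈Q
    ... | no _ | yes refl = v∈far
    ... | no t∉Q | no t≢v = contradiction (s , t , s∈Q , t∈H , t∉Q , t≢v , s~t) ¬leave

    near⊂ : near ⊂ H
    near⊂ = proj₁ ∘ near⁻ , proj₁ Q≠∅ , Q⊆H (proj₂ Q≠∅) , λ q∈ → proj₂ (near⁻ q∈) (proj₂ Q≠∅)

    far⊂ : far ⊂ H
    far⊂ = let w , w∈H , w∉Q , w≢v = beyond in far⊆H , w , w∈H , [ w∉Q , w≢v ]′ ∘ far⁻

    far-part⊆Q : ∀ {P} → P ⊆ far → v ∉ P → P ⊆ Q
    far-part⊆Q P⊆ v∉P u∈P with far⁻ (P⊆ u∈P)
    ... | inj₁ u∈Q = u∈Q
    ... | inj₂ refl = contradiction u∈P v∉P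

    -- A part avoiding `v` lies in `Q`, whose neighbours in `H` all lie in `far`, so the conditions
    -- are inherited. The exit comes from `hanging` applied to `Q` itself.
    far-rooted : Rooted far v α
    far-rooted .root∈ = v∈far
    far-rooted .exit with R .hanging Q v Q≠∅ Q⊆H y∉Q v∈H v∉Q
    ... | inj₁ leave = contradiction leave ¬leave
    ... | inj₂ (s , s∈Q , 1≤αs) = s , Q⊆far s∈Q , 1≤αs
    far-rooted .connected P P≠∅ P⊆ v∉P
      with R .connected P P≠∅ (far⊆H ∘ P⊆) (y∉Q ∘ far-part⊆Q P⊆ v∉P)
    ... | s , t , s∈P , t∈H , t∉P , s~t =
          s , t , s∈P , neighbours (far-part⊆Q P⊆ v∉P s∈P) t∈H s~t , t∉P , s~t
    far-rooted .hanging P u P≠∅ P⊆ v∉P u∈ u∉P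
      with R .hanging P u P≠∅ (far⊆H ∘ P⊆) (y∉Q ∘ far-part⊆Q P⊆ v∉P) (far⊆H u∈) u∉P
    ... | inj₁ (s , t , s∈P , t∈H , t∉P , t≢u , s~t) =
          inj₁ (s , t , s∈P , neighbours (far-part⊆Q P⊆ v∉P s∈P) t∈H s~t , t∉P , t≢u , s~t)
    ... | inj₂ e = inj₂ e

    module _ (far-long : LongPath far v α) where
      open LongPath far-long

      -- The far part is recorded by the weight of its attachment vertex.
      α′ : Fin n → ℕ
      α′ = updateAt α v (λ _ → suc height)

      α′v : α′ v ≡ suc height
      α′v = updateAt-updates v α

      α′u : ∀ {u} → u ≢ v → α′ u ≡ α u
      α′u {u} u≢v = updateAt-minimal u v α u≢v

      α≤α′ : ∀ u → α u ≤ α′ u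
      α≤α′ u with u ≟ v
      -- The field `root≤` of the far part, whose root is `v`.
      ... | yes refl rewrite α′v = root≤
      ... | no u≢v rewrite α′u u≢v = ≤-refl

      near-exit : 1 ≤ α′ v
      near-exit rewrite α′v = s≤s z≤n

      no-edge : ∀ {s t} → s ∈ near → s ≢ v → t ∈ Q → ¬ s ~ t
      no-edge s∈ s≢v t∈Q s~t with far⁻ (neighbours t∈Q (proj₁ (near⁻ s∈)) (~-sym s~t))
      ... | inj₁ s∈Q = proj₂ (near⁻ s∈) s∈Q
      ... | inj₂ s≡v = s≢v s≡v

      -- The new exit `v` replaces those lost with `Q`. A part without `v` has no edge to `Q`, so
      -- its condition comes from `H`; a part containing `v` is first enlarged by `Q` for
      -- connectedness.
      near-rooted : Rooted near y α′
      near-rooted .root∈ = near⁺ (R .root∈) y∉Q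
      near-rooted .exit = v , near⁺ v∈H v∉Q , near-exit
      near-rooted .connected P P≠∅ P⊆ y∉P with v ∈? P
      ... | no v∉P with R .connected P P≠∅ (proj₁ ∘ near⁻ ∘ P⊆) y∉P
      ...   | s , t , s∈P , t∈H , t∉P , s~t =
              s , t , s∈P , near⁺ t∈H (λ t∈Q → no-edge (P⊆ s∈P) (λ { refl → v∉P s∈P }) t∈Q s~t) , t∉P , s~t
      near-rooted .connected P P≠∅ P⊆ y∉P | yes v∈P
        with R .connected (P ∪ Q) (v , x∈p∪q⁺ (inj₁ v∈P)) ([ proj₁ ∘ near⁻ ∘ P⊆ , Q⊆H ]′ ∘ x∈p∪q⁻ P Q)
               ([ y∉P , y∉Q ]′ ∘ x∈p∪q⁻ P Q)
      ... | s , t , s∈PQ , t∈H , t∉PQ , s~t with x∈p∪q⁻ P Q s∈PQ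
      ...   | inj₁ s∈P = s , t , s∈P , near⁺ t∈H (t∉PQ ∘ x∈p∪q⁺ ∘ inj₂) , t∉PQ ∘ x∈p∪q⁺ ∘ inj₁ , s~t
      ...   | inj₂ s∈Q with far⁻ (neighbours s∈Q t∈H s~t)
      ...     | inj₁ t∈Q = contradiction (x∈p∪q⁺ (inj₂ t∈Q)) t∉PQ
      ...     | inj₂ refl = contradiction (x∈p∪q⁺ (inj₁ v∈P)) t∉PQ
      near-rooted .hanging P u P≠∅ P⊆ y∉P u∈ u∉P with v ∈? P
      ... | yes v∈P = inj₂ (v , v∈P , near-exit)
      ... | no v∉P with R .hanging P u P≠∅ (proj₁ ∘ near⁻ ∘ P⊆) y∉P (proj₁ (near⁻ u∈)) u∉P
      ...   | inj₁ (s , t , s∈P , t∈H , t∉P , t≢u , s~t) =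
              inj₁ (s , t , s∈P , near⁺ t∈H (λ t∈Q → no-edge (P⊆ s∈P) (λ { refl → v∉P s∈P }) t∈Q s~t)
                   , t∉P , t≢u , s~t)
      ...   | inj₂ (s , s∈P , 1≤αs) = inj₂ (s , s∈P , ≤-trans 1≤αs (α≤α′ s))

      -- If `v` is the root, the two forests stand side by side; otherwise the far forest hangs
      -- below `v`, in the levels that `α′ v` reserved.
      rejoin-forest : ∀ {d} → α′ y ≤ suc d → Elimination α′ ((_∈ near) ∖ y) d → Elimination α ((_∈ H) ∖ y) d
      rejoin-forest αy≤ E with v ≟ y
      ... | yes refl =
            split (_∈ Q) (_∈? Q)
              (λ { (u∈H , _) u∈Q (w∈H , w≢y) w∉Q u~w → no-edge (near⁺ w∈H w∉Q) w≢y u∈Q (~-sym u~w) })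
              (weaken 0 (λ (_ , u∈Q) → Q⊆far u∈Q , λ { refl → y∉Q u∈Q }) (λ _ → id)
                (≤-pred (≤-trans (≤-reflexive (sym α′v)) αy≤)) forest)
              (weaken 0 (λ { ((u∈H , u≢y) , u∉Q) → near⁺ u∈H u∉Q , u≢y }) (λ {u} _ → ≤-trans (α≤α′ u)) ≤-refl E)
      ... | no v≢y =
            weaken 0 parts (λ _ → id) ≤-refl
              (hang v (near⁺ v∈H v∉Q , v≢y) (_∈? Q) (≤-reflexive (sym α′v)) α≤α′ (proj₂ ∘ near⁻ ∘ proj₁)
                (λ u∈Q (w∈ , _) w≢v u~w → no-edge w∈ w≢v u∈Q (~-sym u~w)) E
                (weaken 0 (λ { u∈Q → Q⊆far u∈Q , λ { refl → v∉Q u∈Q } }) (λ _ → id) ≤-refl forest))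
        where
        parts : ∀ {u} → u ∈ H × u ≢ y → (u ∈ near × u ≢ y) ⊎ u ∈ Q
        parts {u} (u∈H , u≢y) with u ∈? Q
        ... | yes u∈Q = inj₂ u∈Q
        ... | no u∉Q = inj₁ (near⁺ u∈H u∉Q , u≢y)

      -- A near path ending at `v` continues along the far path, whose length and end weight make up
      -- for `α′ v`. Any other end already has its true weight.
      rejoin : LongPath near y α′ → LongPath H y α
      rejoin (longPath {d} {ℓ} {a} r≤ E P 1≤ d<) with a ≟ v
      ... | no a≢v = longPath (≤-trans (α≤α′ y) r≤) (rejoin-forest r≤ E) (Path-mono (proj₁ ∘ near⁻) P)
                       (subst (1 ≤_) (α′u a≢v) 1≤) (subst (λ x → suc d ≤ ℓ + x) (α′u a≢v) d<)
      ... | yes refl = longPath (≤-trans (α≤α′ y) r≤) (rejoin-forest r≤ E)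
                         (append meet (proj₁ ∘ near⁻) far⊆H P path) end-exit bound
        where
        meet : ∀ {x} → x ∈ near → x ∈ far → x ≡ v
        meet x∈near x∈far with far⁻ x∈far
        ... | inj₁ x∈Q = contradiction x∈Q (proj₂ (near⁻ x∈near))
        ... | inj₂ x≡v = x≡v

        open ≤-Reasoning
        bound : suc d ≤ ℓ + len + α end
        bound = begin
          suc d               ≤⟨ d< ⟩
          ℓ + α′ v            ≡⟨ cong (ℓ +_) α′v ⟩
          ℓ + suc height      ≤⟨ +-monoʳ-≤ ℓ height< ⟩
          ℓ + (len + α end)   ≡⟨ sym (+-assoc ℓ len (α end)) ⟩
          ℓ + len + α end     ∎

  -- Inductive step without a separation, and the induction.

  delete : Subset n → Fin n → Subset n
  delete H x = H ∩ ∁ ⁅ x ⁆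

  delete⁻ : ∀ {H x u} → u ∈ delete H x → u ∈ H × u ≢ x
  delete⁻ {H} {x} u∈ with x∈p∩q⁻ H (∁ ⁅ x ⁆) u∈
  ... | u∈H , u∈∁x = u∈H , λ { refl → x∈∁p⇒x∉p u∈∁x (x∈⁅x⁆ x) }

  delete⁺ : ∀ {H x u} → u ∈ H → u ≢ x → u ∈ delete H x
  delete⁺ {x = x} u∈H u≢x = x∈p∩q⁺ (u∈H , x∉p⇒x∈∁p (u≢x ∘ x∈⁅y⁆⇒x≡y x))

  -- As weights these make the neighbours of `x` the exits, each worth the one edge back to `x`.
  adjacency : Fin n → Fin n → ℕ
  adjacency x u = if adj G x u then 1 else 0

  adjacency≤1 : ∀ x u → adjacency x u ≤ 1
  adjacency≤1 x u with adj G x u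
  ... | true = ≤-refl
  ... | false = z≤n

  ~⇒1≤adjacency : ∀ {x u} → x ~ u → 1 ≤ adjacency x u
  ~⇒1≤adjacency x~u rewrite x~u = ≤-refl

  1≤adjacency⇒~ : ∀ {x u} → 1 ≤ adjacency x u → x ~ u
  1≤adjacency⇒~ {x} {u} 1≤ with adj G x u
  ... | true = refl

  -- A part violating a condition would give a separation of `H`: at `x` for `connected`, and at `u`
  -- for `hanging`, since such a part also has no neighbour of `x`.
  delete-rooted : ∀ {H y x} → ¬ ∃₂ (Separation H y) → y ∈ H → x ∈ H → y ≢ x →
                  (∃ λ t → t ∈ H × x ~ t) → Rooted (delete H x) y (adjacency x)
  delete-rooted _ y∈H x∈H y≢x _ .root∈ = delete⁺ y∈H y≢x
  delete-rooted _ y∈H x∈H y≢x (t , t∈H , x~t) .exit =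
    t , delete⁺ t∈H (~⇒≢ x~t ∘ sym) , ~⇒1≤adjacency x~t
  delete-rooted {H} {y} {x} ¬sep y∈H x∈H y≢x _ .connected Q Q≠∅ Q⊆ y∉Q
    with any? (λ s → any? λ t → s ∈? Q ×-dec t ∈? delete H x ×-dec ¬? (t ∈? Q) ×-dec adj G s t ≟ᵇ true)
  ... | yes edge = edge
  ... | no ∄edge = ⊥-elim (¬sep
        (Q , x , separation Q≠∅ (proj₁ ∘ delete⁻ ∘ Q⊆) y∉Q x∈H
          (λ x∈Q → proj₂ (delete⁻ {H} (Q⊆ x∈Q)) refl) (y , y∈H , y∉Q , y≢x)
          λ (s , t , s∈Q , t∈H , t∉Q , t≢x , s~t) → ∄edge (s , t , s∈Q , delete⁺ t∈H t≢x , t∉Q , s~t)))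
  delete-rooted {H} {y} {x} ¬sep y∈H x∈H y≢x _ .hanging Q u Q≠∅ Q⊆ y∉Q u∈ u∉Q
    with any? (λ s → any? λ t →
                s ∈? Q ×-dec t ∈? delete H x ×-dec ¬? (t ∈? Q) ×-dec ¬? (t ≟ u) ×-dec adj G s t ≟ᵇ true)
       | any? (λ s → s ∈? Q ×-dec 1 ≤? adjacency x s)
  ... | yes leave | _ = inj₁ leave
  ... | no _ | yes e = inj₂ e
  ... | no ¬leave | no ¬exit = ⊥-elim (¬sep
        (Q , u , separation Q≠∅ (proj₁ ∘ delete⁻ ∘ Q⊆) y∉Q (proj₁ (delete⁻ u∈)) u∉Q
          (x , x∈H , (λ x∈Q → proj₂ (delete⁻ {H} (Q⊆ x∈Q)) refl) , λ { refl → proj₂ (delete⁻ {H} u∈) refl })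
          stuck))
    where
    stuck : ¬ ∃₂ λ s t → s ∈ Q × t ∈ H × t ∉ Q × t ≢ u × s ~ t
    stuck (s , t , s∈Q , t∈H , t∉Q , t≢u , s~t) with t ≟ x
    ... | yes refl = ¬exit (s , s∈Q , ~⇒1≤adjacency (~-sym s~t))
    ... | no t≢x = ¬leave (s , t , s∈Q , delete⁺ t∈H t≢x , t∉Q , t≢u , s~t)

  -- With `x` on top, `m` blank levels at the bottom give every other non-root vertex room for
  -- weights up to `α x`.
  restore-forest : ∀ {H y x α m d} → x ∈ H → (∀ u → u ∈ H × u ≢ y → α u ≤ α x) → α x ≡ suc m →
                   Elimination (adjacency x) ((_∈ delete H x) ∖ y) d →
                   Elimination α ((_∈ H) ∖ y) (suc (m + d))
  restore-forest {x = x} {m = m} {d} x∈H max αx E =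
    remove x (λ _ → ≤-trans (≤-reflexive αx) (s≤s (m≤m+n m d)))
      (weaken m (λ { ((u∈H , u≢y) , u≢x) → delete⁺ u∈H u≢x , u≢y })
        (λ { {u} {r} ((u∈H , u≢y) , _) _ →
               ≤-trans (max u (u∈H , u≢y)) (≤-trans (≤-reflexive αx) (s≤s (m≤m+n m r))) }) ≤-refl E)

  -- The path to a neighbour of `x` gains the edge to `x`, and the end weight `α x` pays for the
  -- levels added to the forest. If `α y` exceeds all this, the trivial path at `y` suffices.
  extend : ∀ {H y x α m} → x ∈ H → (∀ u → u ∈ H × u ≢ y → α u ≤ α x) → α x ≡ suc m →
           y ∈ H → LongPath (delete H x) y (adjacency x) → LongPath H y α
  extend {H} {y} {x} {α} {m} x∈H max αx y∈H (longPath {d} {ℓ} {z} _ E P 1≤ d<) with α y ≤? suc (suc (m + d))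
  ... | yes αy≤ = longPath αy≤ (restore-forest x∈H max αx E) (append meet (proj₁ ∘ delete⁻) proj₁ P last-edge)
                      (≤-trans (s≤s z≤n) (≤-reflexive (sym αx))) bound
    where
    z∈ : z ∈ delete H x
    z∈ = end∈ P

    last-edge : Path (λ u → u ∈ H × (u ≡ z ⊎ u ≡ x)) z x 1
    last-edge = step (proj₁ (delete⁻ z∈) , inj₁ refl) (~-sym (1≤adjacency⇒~ 1≤))
                  (stop ((x∈H , inj₂ refl) , λ { refl → proj₂ (delete⁻ {H} z∈) refl }))

    meet : ∀ {u} → u ∈ delete H x → u ∈ H × (u ≡ z ⊎ u ≡ x) → u ≡ z
    meet _ (_ , inj₁ u≡z) = u≡z
    meet u∈ (_ , inj₂ refl) = contradiction refl (proj₂ (delete⁻ {H} u∈))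

    open ≤-Reasoning
    bound : suc (suc (m + d)) ≤ ℓ + 1 + α x
    bound = begin
      suc (suc (m + d))             ≡⟨ cong suc (+-comm (suc m) d) ⟩
      suc d + suc m                 ≤⟨ +-monoˡ-≤ (suc m) d< ⟩
      ℓ + adjacency x z + suc m     ≤⟨ +-monoˡ-≤ (suc m) (+-monoʳ-≤ ℓ (adjacency≤1 x z)) ⟩
      ℓ + 1 + suc m                 ≡⟨ cong (ℓ + 1 +_) (sym αx) ⟩
      ℓ + 1 + α x                   ∎
  ... | no αy≰ with α y in αy
  ...   | zero = contradiction z≤n αy≰
  ...   | suc e =
            longPath (≤-reflexive αy)
              (weaken 0 id (λ _ → id) (≤-pred (≰⇒≥ αy≰)) (restore-forest x∈H max αx E)) (stop y∈H)
              (≤-trans (s≤s z≤n) (≤-reflexive (sym αy))) (≤-reflexive (sym αy))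

  -- Induction on the size of `H`, bounded by `m`. At a separation the far part comes first, as its
  -- height becomes a weight in the near part. Otherwise a non-root vertex of greatest weight is
  -- deleted.
  long-path : ∀ m {H y α} → ∣ H ∣ < m → Rooted H y α → LongPath H y α
  long-path (suc m) {H} {y} {α} (s≤s ∣H∣≤m) R with separation? H y
  ... | yes (Q , v , sep) =
        let far-long = long-path m (<-≤-trans (p⊂q⇒∣p∣<∣q∣ (far⊂ R sep)) ∣H∣≤m) (far-rooted R sep)
        in rejoin R sep far-long
             (long-path m (<-≤-trans (p⊂q⇒∣p∣<∣q∣ (near⊂ R sep)) ∣H∣≤m) (near-rooted R sep far-long))
  ... | no ¬sep with any? (λ w → w ∈? H ×-dec ¬? (w ≟ y))
  ...   | no only-root with R .exit
  ...     | a , a∈H , 1≤αa with a ≟ y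
  ...       | no a≢y = contradiction (a , a∈H , a≢y) only-root
  ...       | yes refl with α a in αa | 1≤αa
  ...         | suc e | _ =
                longPath (≤-reflexive αa) (empty λ {u} u∈ → only-root (u , u∈)) (stop a∈H)
                  (≤-trans (s≤s z≤n) (≤-reflexive (sym αa))) (≤-reflexive (sym αa))
  long-path (suc m) {H} {y} {α} (s≤s ∣H∣≤m) R | no ¬sep | yes non-root
    with maximiser (λ u → u ∈? H ×-dec ¬? (u ≟ y)) α non-root
  ... | x , (x∈H , x≢y) , max =
        extend x∈H max (sym (suc-pred (α x) {{>-nonZero 1≤αx}})) (R .root∈)
          (long-path m (<-≤-trans (p⊂q⇒∣p∣<∣q∣ delete⊂) ∣H∣≤m)
            (delete-rooted ¬sep (R .root∈) x∈H (x≢y ∘ sym) x-nbr))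
    where
    delete⊂ : delete H x ⊂ H
    delete⊂ = proj₁ ∘ delete⁻ , x , x∈H , λ x∈ → proj₂ (delete⁻ {H} x∈) refl

    x-nbr : ∃ λ t → t ∈ H × x ~ t
    x-nbr with R .connected ⁅ x ⁆ (x , x∈⁅x⁆ x) (λ u∈x → subst (_∈ H) (sym (x∈⁅y⁆⇒x≡y x u∈x)) x∈H)
                 (x≢y ∘ sym ∘ x∈⁅y⁆⇒x≡y x)
    ... | s , t , s∈x , t∈H , _ , s~t = t , t∈H , subst (_~ t) (x∈⁅y⁆⇒x≡y x s∈x) s~t

    1≤αx : 1 ≤ α x
    -- All of `H` but the root is a part attached only at `y`, so it contains an exit.
    1≤αx with R .hanging (delete H y) y (x , delete⁺ x∈H x≢y) (proj₁ ∘ delete⁻)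
                (λ y∈ → proj₂ (delete⁻ {H} y∈) refl) (R .root∈) (λ y∈ → proj₂ (delete⁻ {H} y∈) refl)
    ... | inj₁ (_ , t , _ , t∈H , t∉ , t≢y , _) = contradiction (delete⁺ t∈H t≢y) t∉
    ... | inj₂ (s , s∈ , 1≤αs) = ≤-trans 1≤αs (max s (delete⁻ s∈))

  -- Long cycles in critical graphs.

  no-room : ∀ {α S} → Elimination α S 0 → ∀ {u} → ¬ S u
  no-room (empty ∄) = ∄
  no-room (split T T? _ E F) {u} Su with T? u
  ... | yes Tu = no-room E (Su , Tu)
  ... | no ¬Tu = no-room F (Su , ¬Tu)

  -- In `G` without `x`, a path from `y` to a neighbour of `x` is at least as long as the forest is
  -- high. Removing `x` and `y` first costs two levels, matched by the two cycle edges at `x`.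
  cycle-from-edge : ∀ {q x y w} → ¬ Colorable q G → VertexDeletionColourings q →
                    x ~ y → w ≢ x → w ≢ y → Σ ℕ λ L → HasCycleOfLength G L × n ≤ suc q ^ L
  cycle-from-edge {q} {x} {y} {w} ¬col col x~y w≢x w≢y
    with long-path (suc ∣ delete full x ∣) ≤-refl
           (delete-rooted ¬sep ∈⊤ ∈⊤ (~⇒≢ x~y ∘ sym) (y , ∈⊤ , x~y))
    where
    ¬sep : ¬ ∃₂ (Separation full y)
    ¬sep (Q , v , separation Q≠∅ _ _ _ v∉Q (t , _ , t∉Q , t≢v) stuck)
      with no-cut-vertex ¬col col Q v Q≠∅ v∉Q (t , t∉Q , t≢v)
    ... | s , t , s∈Q , t∉Q , t≢v , s~t = stuck (s , t , s∈Q , ∈⊤ , t∉Q , t≢v , s~t)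
  -- The third vertex `w` forces positive height, so the path has an edge and closes to a genuine
  -- cycle.
  ... | longPath {zero} _ E _ _ _ = contradiction (delete⁺ ∈⊤ w≢x , w≢y) (no-room E)
  ... | longPath {suc d} {ℓ} {z} _ E P 1≤ d< = close P d≤ℓ
    where
    d≤ℓ : suc d ≤ ℓ
    d≤ℓ = ≤-pred (≤-trans d< (≤-trans (+-monoʳ-≤ ℓ (adjacency≤1 x z)) (≤-reflexive (+-comm ℓ 1))))

    forest : Elimination (λ _ → 0) (_∈ full) (3 + d)
    forest = remove x (λ _ → z≤n) (remove y (λ _ → z≤n)
      (weaken 0 (λ { ((_ , u≢x) , u≢y) → delete⁺ ∈⊤ u≢x , u≢y }) (λ _ _ → z≤n) ≤-refl E))

    close : ∀ {ℓ} → Path (_∈ delete full x) y z ℓ → suc d ≤ ℓ →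
            Σ ℕ λ L → HasCycleOfLength G L × n ≤ suc q ^ L
    close {suc m} P d<ℓ =
        3 + m
      , closePath (step {S = _∈ full} ∈⊤ x~y (Path-mono (λ u∈ → ∈⊤ , proj₂ (delete⁻ {full} u∈)) P))
          (~-sym (1≤adjacency⇒~ 1≤))
      , ≤-trans (order≤ ¬col col (λ _ → ∈⊤) forest) (^-monoʳ-≤ (suc q) (s≤s (s≤s d<ℓ)))

-- The inequality between `L` and the quotient of logarithms is expressed as a bound on `n` by a
-- power of `k`.
theorem1p1 : ∀ (k n : ℕ) → 4 ≤ k → k + 2 ≤ n → (G : Graph n) → Critical k G →
    Σ ℕ λ L → HasCycleOfLength G L × n ≤ k ^ (100 * L)
theorem1p1 (suc zero) _ (s≤s ())
theorem1p1 (suc (suc zero)) _ (s≤s (s≤s ()))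
theorem1p1 k@(suc (suc (suc _))) (suc (suc (suc n))) _ _ G crit@(¬col , _)
  -- As vertex 1 is no cut vertex, vertex 0 has a neighbour other than 1. This yields an edge, with
  -- 1 as the third vertex.
  with no-cut-vertex G ¬col (critical⇒vertexDeletionColourings G {k} crit) ⁅ zero ⁆ (suc zero)
         (zero , x∈⁅x⁆ _) ((λ ()) ∘ x∈⁅y⁆⇒x≡y zero) (suc (suc zero) , (λ ()) ∘ x∈⁅y⁆⇒x≡y zero , λ ())
... | s , t , s∈ , _ , t≢1 , s~t
  with L , cycle , n≤ ←
         cycle-from-edge G {w = suc zero} ¬col (critical⇒vertexDeletionColourings G {k} crit) s~t
         (λ { refl → case x∈⁅y⁆⇒x≡y zero s∈ of λ () }) (t≢1 ∘ sym)
  = L , cycle , ≤-trans n≤ (^-monoʳ-≤ k (m≤n*m L 100))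
theorem1p1 (suc (suc (suc _))) zero _ ()
theorem1p1 (suc (suc (suc _))) (suc zero) _ (s≤s ())
theorem1p1 (suc (suc (suc _))) (suc (suc zero)) _ (s≤s (s≤s ()))
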